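{- Let $N$ be a positive integer, let $G$ be a graph with $n \le N$ vertices, regarded as a subgraph of the complete graph $K_N$, and let $0<k\le N$. For integers $j,m\ge 0$ let $b_{j,m,n}$ be the number of ways of choosing $m$ pairwise disjoint bad components (an unordered collection) of $K_N^{ -G}$ such that the cardinality of the union of the vertex sets of the chosen bad components is $j$. Then $$C^k(K_N^{ -G}) = \sum_{j=0}^{n}\sum_{m=0}^{j}(-1)^m\, b_{j,m,n}\, S(N-j,k-m).$$
   Context: Graphs are finite and simple. A graph composition of a graph $H$ is a partition of $V(H)$ into nonempty blocks (called components) each of which induces a connected subgraph of $H$. $C^k(H)$ denotes the number of graph compositions of $H$ with exactly $k$ components. For a subgraph $G$ of $K_N$, $K_N^{ -G}$ is the graph with vertex set $V(K_N)$ and edge set $E(K_N)\setminus E(G)$. A bad component of $K_N^{ -G}$ is a nonempty set $B\subseteq V(G)$ such that the complement of $G$, restricted to $B$ (i.e. the subgraph of the complement of $G$ induced by $B$), is disconnected. $S(a,b)$ is the Stirling number of the second kind, the number of partitions of an $a$-element set into exactly $b$ nonempty subsets, with $S(0,0)=1$, $S(a,0)=0$ for $a\ge1$, and $S(a,b)=0$ if $b<0$ or $b>a$. -}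

module Defs where

open import Data.Fin using (Fin)
open import Data.Fin.Properties using (_≟_; any?)
open import Data.Fin.Subset using (Subset; inside; outside; _∈_; _⊆_; _⊂_; _∩_; _-_; ⋃; ⊤; Empty; Nonempty; ∣_∣)
open import Data.Fin.Subset.Induction using (⊂-wellFounded)
open import Data.Fin.Subset.Properties using (_∈?_; _⊆?_; nonempty?; ∈⊤; x∈p∩q⁺; x∈p⇒p-x⊂p; x∈p∧x≢y⇒x∈p-y; p─q⊆p)
open import Data.Integer using (ℤ; +_; -[1+_])
open import Data.List using (List; []; _∷_; _++_; map; filter; length)
open import Data.List.Relation.Unary.All using (All)
open import Data.List.Relation.Unary.AllPairs using (AllPairs; allPairs?)
open import Data.Nat as ℕ using (ℕ; zero; suc)
open import Data.Product using (_×_; _,_; proj₁; proj₂; map₂; swap; ∃)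
open import Data.Sum using (_⊎_; inj₁; inj₂)
open import Data.Vec using ([]; _∷_)
open import Data.Bool using () renaming (_≟_ to _≟ᵇ_)
open import Data.Vec.Properties using (≡-dec)
open import Function using (_∘_)
open import Induction.WellFounded using (Acc; acc)
open import Level using (0ℓ)
open import Relation.Binary using (Rel; Symmetric; Irreflexive) renaming (Decidable to Decidable₂)
open import Relation.Binary.Construct.Closure.ReflexiveTransitive using (Star; ε; _◅_; gmap)
open import Relation.Binary.PropositionalEquality using (_≡_; _≢_; refl; sym)
open import Relation.Nullary using (yes; no; ¬_; ¬?; _×-dec_; _→-dec_)
open import Relation.Nullary.Decidable using () renaming (map′ to mapDec)
open import Relation.Unary using (Pred; Decidable)

import Algebra.Properties.CommutativeMonoid.Sum as Sum
import Data.Fin.Properties as Fin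
import Data.Integer.Properties as ℤ
import Data.List.Relation.Unary.All as All

open Sum ℤ.+-0-commutativeMonoid public using (sum⁺-syntax)

-- Finite simple graphs whose vertices lie in Fin N, i.e. the subgraphs of K_N.

record Graph (N : ℕ) : Set₁ where
  field
    V       : Subset N
    Adj     : Rel (Fin N) 0ℓ
    Adj?    : Decidable₂ Adj
    symm    : Symmetric Adj
    irrefl  : Irreflexive _≡_ Adj
    Adj⇒∈V  : ∀ {u v} → Adj u v → u ∈ V

open Graph public

K : ∀ N → Graph N
K N = record
  { V      = ⊤
  ; Adj    = _≢_
  ; Adj?   = λ u v → ¬? (u ≟ v)
  ; symm   = λ u≢v → u≢v ∘ sym
  ; irrefl = λ u≡v u≢v → u≢v u≡v
  ; Adj⇒∈V = λ _ → ∈⊤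
  }

infixl 6 _∖E_

_∖E_ : ∀ {N} → Graph N → Graph N → Graph N
H ∖E G = record
  { V      = V H
  ; Adj    = λ u v → Adj H u v × ¬ Adj G u v
  ; Adj?   = λ u v → Adj? H u v ×-dec ¬? (Adj? G u v)
  ; symm   = λ (h , ¬g) → symm H h , ¬g ∘ symm G
  ; irrefl = λ u≡v → irrefl H u≡v ∘ proj₁
  ; Adj⇒∈V = Adj⇒∈V H ∘ proj₁
  }

K⁻ : ∀ {N} → Graph N → Graph N
K⁻ {N} G = K N ∖E G

-- The complement has the vertex set of G, not all of Fin N.

complement : ∀ {N} → Graph N → Graph N
complement G = record
  { V      = V G
  ; Adj    = λ u v → (u ∈ V G × v ∈ V G) × u ≢ v × ¬ Adj G u v
  ; Adj?   = λ u v → (u ∈? V G ×-dec v ∈? V G) ×-dec ¬? (u ≟ v) ×-dec ¬? (Adj? G u v)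
  ; symm   = λ (uv∈ , u≢v , ¬g) → swap uv∈ , u≢v ∘ sym , ¬g ∘ symm G
  ; irrefl = λ u≡v (_ , u≢v , _) → u≢v u≡v
  ; Adj⇒∈V = proj₁ ∘ proj₁
  }

induced : ∀ {N} → Graph N → Subset N → Graph N
induced H B = record
  { V      = V H ∩ B
  ; Adj    = λ u v → Adj H u v × u ∈ B × v ∈ B
  ; Adj?   = λ u v → Adj? H u v ×-dec u ∈? B ×-dec v ∈? B
  ; symm   = λ (h , uv∈) → symm H h , swap uv∈
  ; irrefl = λ u≡v → irrefl H u≡v ∘ proj₁
  ; Adj⇒∈V = λ (h , u∈B , _) → x∈p∩q⁺ (Adj⇒∈V H h , u∈B)
  }

-- An element of Star (Adj H) u v is a walk from u to v in H.

Connected : ∀ {N} → Graph N → Set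
Connected H = ∀ u v → u ∈ V H → v ∈ V H → Star (Adj H) u v

-- Search for a walk whose vertices after the first lie in S, removing each
-- vertex from S as it is visited.

module _ {N} {R : Rel (Fin N) 0ℓ} (R? : Decidable₂ R) where

  private
    Into : Subset N → Rel (Fin N) 0ℓ
    Into S u v = R u v × v ∈ S

    avoid : ∀ {S u y} z → Star (Into S) u y →
            Star (Into (S - z)) u y ⊎ Star (Into (S - z)) z y
    avoid z ε = inj₁ ε
    avoid z (_◅_ {j = v} (r , v∈S) w) with avoid z w
    ... | inj₂ w′ = inj₂ w′
    ... | inj₁ w′ with v ≟ z
    ...   | yes refl = inj₂ w′
    ...   | no v≢z   = inj₁ ((r , x∈p∧x≢y⇒x∈p-y v∈S v≢z) ◅ w′)

    restart : ∀ {S z y} → Star (Into S) z y → Star (Into (S - z)) z y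
    restart {z = z} w with avoid z w
    ... | inj₁ w′ = w′
    ... | inj₂ w′ = w′

    into? : ∀ S → Acc _⊂_ S → Decidable₂ (Star (Into S))
    into? S (acc rs) x y with x ≟ y
    ... | yes refl = yes ε
    ... | no x≢y   = mapDec to from (any? step?)
      where
      Step : Pred (Fin N) 0ℓ
      Step z = ∃ λ (_ : z ∈ S) → R x z × Star (Into (S - z)) z y

      step? : Decidable Step
      step? z with z ∈? S
      ... | no z∉S  = no (z∉S ∘ proj₁)
      ... | yes z∈S = mapDec (z∈S ,_) proj₂
                        (R? x z ×-dec into? (S - z) (rs (x∈p⇒p-x⊂p z∈S)) z y)

      to : ∃ Step → Star (Into S) x y
      to (z , z∈S , r , w) =
        (r , z∈S) ◅ gmap (λ v → v) (map₂ (p─q⊆p S _)) w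

      from : Star (Into S) x y → ∃ Step
      from ε                 with () ← x≢y refl
      from ((r , z∈S) ◅ w) = _ , z∈S , r , restart w

  star? : Decidable₂ (Star R)
  star? x y = mapDec (gmap (λ v → v) proj₁) (gmap (λ v → v) (_, ∈⊤))
                (into? ⊤ (⊂-wellFounded ⊤) x y)

connected? : ∀ {N} → Decidable (Connected {N})
connected? H = Fin.all? λ u → Fin.all? λ v →
  u ∈? V H →-dec v ∈? V H →-dec star? (Adj? H) u v

-- subsets N lists every subset of Fin N exactly once, so its sublists (each
-- produced once) are in bijection with the unordered collections of distinct
-- subsets of Fin N.

subsets : ∀ N → List (Subset N)
subsets zero    = [] ∷ []
subsets (suc N) = map (inside ∷_) (subsets N) ++ map (outside ∷_) (subsets N)

sublists : ∀ {A : Set} → List A → List (List A)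
sublists []       = [] ∷ []
sublists (x ∷ xs) = map (x ∷_) (sublists xs) ++ sublists xs

Family : ℕ → Set
Family N = List (Subset N)

families : ∀ N → List (Family N)
families N = sublists (subsets N)

countFamilies : ∀ {N} {P : Pred (Family N) 0ℓ} → Decidable P → ℕ
countFamilies {N} P? = length (filter P? (families N))

Disjoint : ∀ {N} → Rel (Subset N) 0ℓ
Disjoint p q = Empty (p ∩ q)

disjoint? : ∀ {N} → Decidable₂ (Disjoint {N})
disjoint? p q = ¬? (nonempty? (p ∩ q))

IsPartition : ∀ {N} → Subset N → Family N → Set
IsPartition U 𝓟 = All Nonempty 𝓟 × AllPairs Disjoint 𝓟 × ⋃ 𝓟 ≡ U

isPartition? : ∀ {N} (U : Subset N) → Decidable (IsPartition U)
isPartition? U 𝓟 =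
  All.all? nonempty? 𝓟 ×-dec allPairs? disjoint? 𝓟 ×-dec ≡-dec _≟ᵇ_ (⋃ 𝓟) U

IsComposition : ∀ {N} → Graph N → Family N → Set
IsComposition H 𝓟 = IsPartition (V H) 𝓟 × All (Connected ∘ induced H) 𝓟

isComposition? : ∀ {N} (H : Graph N) → Decidable (IsComposition H)
isComposition? H 𝓟 =
  isPartition? (V H) 𝓟 ×-dec All.all? (connected? ∘ induced H) 𝓟

C : ∀ {N} → ℕ → Graph N → ℕ
C k H = countFamilies λ 𝓟 → isComposition? H 𝓟 ×-dec length 𝓟 ℕ.≟ k

Bad : ∀ {N} → Graph N → Subset N → Set
Bad G B = Nonempty B × B ⊆ V G × ¬ Connected (induced (complement G) B)

bad? : ∀ {N} (G : Graph N) → Decidable (Bad G)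
bad? G B = nonempty? B ×-dec B ⊆? V G ×-dec ¬? (connected? (induced (complement G) B))

IsBadFamily : ∀ {N} → Graph N → ℕ → ℕ → Family N → Set
IsBadFamily G j m 𝓑 =
  All (Bad G) 𝓑 × AllPairs Disjoint 𝓑 × length 𝓑 ≡ m × ∣ ⋃ 𝓑 ∣ ≡ j

isBadFamily? : ∀ {N} (G : Graph N) j m → Decidable (IsBadFamily G j m)
isBadFamily? G j m 𝓑 =
  All.all? (bad? G) 𝓑 ×-dec allPairs? disjoint? 𝓑 ×-dec
  length 𝓑 ℕ.≟ m ×-dec ∣ ⋃ 𝓑 ∣ ℕ.≟ j

-- The number written b_{j,m,n}, where n = ∣ V G ∣.

b : ∀ {N} → Graph N → ℕ → ℕ → ℕ
b G j m = countFamilies (isBadFamily? G j m)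

-- Stirling numbers of the second kind; the second index may be negative.

S : ℕ → ℤ → ℕ
S a (+ c)    = countFamilies λ 𝓟 → isPartition? (⊤ {a}) 𝓟 ×-dec length 𝓟 ℕ.≟ c
S a -[1+ _ ] = 0

{-# OPTIONS --safe #-}
-- A block induces a disconnected subgraph of K⁻ G exactly when it is bad, so
-- C k (K⁻ G) sums ∏ (1 − [x bad]) over the partitions into k blocks. Let T x be
-- the operator on functions of (uncovered set, number of blocks still to be
-- placed) that places the block x if it fits into the uncovered set. The T x
-- commute and square to zero, so, over all subsets x,
--   ∏ (1 + v x T x) ∘ ∏ (1 + w x T x) = ∏ (1 + (v x + w x) T x).
-- With v x = − [x bad] and w x = 1 the right side counts compositions; on the
-- left the second factor counts the partitions of what a family of bad
-- components leaves uncovered, a Stirling number, and expanding the first one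
-- gives the signed sum over such families.

module Submission where

open import Defs
open import Data.Bool using (if_then_else_) renaming (_≟_ to _≟ᵇ_)
open import Data.Empty using (⊥-elim)
open import Data.Fin using (toℕ)
open import Data.Fin.Properties using (_≟_; any?)
open import Data.Fin.Subset using (Subset; Side; inside; outside; _∈_; _⊆_; _∪_; _─_; ⋃; ⊤; ⊥; ∁; Nonempty; ∣_∣)
open import Data.Fin.Subset.Properties
open import Data.Integer using (ℤ; +_; -[1+_]; 0ℤ; 1ℤ; -1ℤ; _+_; -_; _-_; _*_; _^_; pred)
open import Data.Integer.Tactic.RingSolver using (solve-∀)
open import Data.List using (List; []; _∷_; _++_; map; filter; length)
open import Data.List.Relation.Unary.All using (All; []; _∷_)
open import Data.List.Relation.Unary.AllPairs using (AllPairs; []; _∷_; allPairs?)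
open import Data.Nat using (ℕ; zero; suc; _<_; _≤_; _∸_; z≤n; s≤s)
open import Data.Product using (_×_; _,_; proj₁; proj₂; swap; uncurry)
open import Data.Sum using ([_,_]′)
open import Data.Unit using (tt)
open import Data.Vec using ([]; _∷_; here; there)
open import Data.Vec.Properties using (≡-dec)
open import Function using (_∘_; id; case_of_; _⇔_; mk⇔; Equivalence)
open import Function.Properties.Equivalence using () renaming (sym to ⇔-sym)
open import Level using (0ℓ)
open import Relation.Binary.Construct.Closure.ReflexiveTransitive using (Star; ε; _◅_; _◅◅_; gmap; reverse)
open import Relation.Binary.PropositionalEquality using (_≡_; _≢_; _≗_; refl; sym; trans; cong; cong₂; subst; module ≡-Reasoning)
open import Relation.Nullary using (Dec; yes; no; does; ¬_; ¬?; _×-dec_)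
open import Relation.Nullary.Decidable using (does-⇔; decidable-stable; dec-true; dec-false)
open import Relation.Unary using (Pred; Decidable)

import Algebra.Properties.CommutativeMonoid.Sum as Sum
import Data.Integer.Properties as ℤ
import Data.List.Relation.Unary.All as All
import Data.Nat.Properties as ℕ

open Sum ℤ.+-0-commutativeMonoid using (sum-syntax; sum-cong-≗; sum-replicate-zero; ∑-distrib-+)
open Equivalence using (to; from)
open ≡-Reasoning

private
  variable
    A B P Q : Set
    N : ℕ

-- Opaque, so that unification recovers the decision from its bracket.
opaque
  ι : Dec P → ℤ
  ι d = if does d then 1ℤ else 0ℤ

  ι-cong : P ⇔ Q → (p : Dec P) (q : Dec Q) → ι p ≡ ι q
  ι-cong P⇔Q p q = cong (if_then 1ℤ else 0ℤ) (does-⇔ P⇔Q p q)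

  ι-true : (p : Dec P) → P → ι p ≡ 1ℤ
  ι-true p x = cong (if_then 1ℤ else 0ℤ) (dec-true p x)

  ι-false : (p : Dec P) → ¬ P → ι p ≡ 0ℤ
  ι-false p ¬x = cong (if_then 1ℤ else 0ℤ) (dec-false p ¬x)

  ι-× : (p : Dec P) (q : Dec Q) → ι (p ×-dec q) ≡ ι p * ι q
  ι-× (yes _) (yes _) = refl
  ι-× (yes _) (no _)  = refl
  ι-× (no _)  _       = refl

-- Sums over lists

sumOver : List A → (A → ℤ) → ℤ
sumOver []       f = 0ℤ
sumOver (x ∷ xs) f = f x + sumOver xs f

infixl 10 sumOver
syntax sumOver xs (λ x → t) = ∑[ x ∈ xs ] t

∑∈-cong : (xs : List A) {f g : A → ℤ} → f ≗ g → ∑[ x ∈ xs ] f x ≡ ∑[ x ∈ xs ] g x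
∑∈-cong []       f≗g = refl
∑∈-cong (x ∷ xs) f≗g = cong₂ _+_ (f≗g x) (∑∈-cong xs f≗g)

∑∈-++ : (xs ys : List A) (f : A → ℤ) → ∑[ x ∈ xs ++ ys ] f x ≡ ∑[ x ∈ xs ] f x + ∑[ y ∈ ys ] f y
∑∈-++ []       ys f = sym (ℤ.+-identityˡ _)
∑∈-++ (x ∷ xs) ys f = trans (cong (λ s → f x + s) (∑∈-++ xs ys f)) (sym (ℤ.+-assoc (f x) _ _))

∑∈-map : (h : A → B) (xs : List A) (f : B → ℤ) → ∑[ y ∈ map h xs ] f y ≡ ∑[ x ∈ xs ] f (h x)
∑∈-map h []       f = refl
∑∈-map h (x ∷ xs) f = cong (λ s → f (h x) + s) (∑∈-map h xs f)

∑∈-zero : (xs : List A) → ∑[ x ∈ xs ] 0ℤ ≡ 0ℤ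
∑∈-zero []       = refl
∑∈-zero (x ∷ xs) = trans (ℤ.+-identityˡ _) (∑∈-zero xs)

*-distribˡ-∑∈ : (a : ℤ) (xs : List A) (f : A → ℤ) → a * ∑[ x ∈ xs ] f x ≡ ∑[ x ∈ xs ] (a * f x)
*-distribˡ-∑∈ a []       f = ℤ.*-zeroʳ a
*-distribˡ-∑∈ a (x ∷ xs) f = trans (ℤ.*-distribˡ-+ a (f x) _) (cong (λ s → a * f x + s) (*-distribˡ-∑∈ a xs f))

∑-∑∈-comm : ∀ n (xs : List A) (f : ℕ → A → ℤ) →
            ∑[ i < n ] ∑[ x ∈ xs ] f (toℕ i) x ≡ ∑[ x ∈ xs ] ∑[ i < n ] f (toℕ i) x
∑-∑∈-comm n []       f = sum-replicate-zero n
∑-∑∈-comm n (x ∷ xs) f =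
  trans (∑-distrib-+ {n} (λ i → f (toℕ i) x) _) (cong (λ s → ∑[ i < n ] f (toℕ i) x + s) (∑-∑∈-comm n xs f))

length-filter : {P : Pred A 0ℓ} (P? : Decidable P) (xs : List A) →
                + length (filter P? xs) ≡ ∑[ x ∈ xs ] ι (P? x)
length-filter P? []       = refl
length-filter P? (x ∷ xs) with P? x
... | yes p = cong₂ _+_ (sym (ι-true (yes p) p)) (length-filter P? xs)
... | no ¬p = trans (sym (ℤ.+-identityˡ _)) (cong₂ _+_ (sym (ι-false (no ¬p) ¬p)) (length-filter P? xs))

∑-single : ∀ n (f : ℕ → ℤ) {a} → a < n → (∀ i → i ≢ a → f i ≡ 0ℤ) → ∑[ i < n ] f (toℕ i) ≡ f a
∑-single (suc n) f {zero} _ f≡0 =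
  trans (cong (λ s → f 0 + s) (trans (sum-cong-≗ {n} (λ i → f≡0 (suc (toℕ i)) λ ())) (sum-replicate-zero n)))
        (ℤ.+-identityʳ (f 0))
∑-single (suc n) f {suc a} (s≤s a<n) f≡0 =
  trans (cong₂ _+_ (f≡0 0 λ ()) (∑-single n (f ∘ suc) a<n λ i i≢a → f≡0 (suc i) (i≢a ∘ ℕ.suc-injective)))
        (ℤ.+-identityˡ _)

-- Set operations

-- An empty block would still fit after being placed, so nonemptiness is what makes `step-step`
-- true.
Admissible : Subset N → Subset N → Set
Admissible U x = Nonempty x × x ⊆ U

admissible? : (U : Subset N) → Decidable (Admissible U)
admissible? U x = nonempty? x ×-dec x ⊆? U

admissible-⊤ : {x : Subset N} → Nonempty x → Admissible ⊤ x
admissible-⊤ x≢∅ = x≢∅ , ⊆⊤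

⊤─p≡∁p : (p : Subset N) → ⊤ ─ p ≡ ∁ p
⊤─p≡∁p []            = refl
⊤─p≡∁p (inside  ∷ p) = cong (outside ∷_) (⊤─p≡∁p p)
⊤─p≡∁p (outside ∷ p) = cong (inside  ∷_) (⊤─p≡∁p p)

∣⊤─p∣≡N∸∣p∣ : (p : Subset N) → ∣ ⊤ ─ p ∣ ≡ N ∸ ∣ p ∣
∣⊤─p∣≡N∸∣p∣ p = trans (cong ∣_∣ (⊤─p≡∁p p)) (∣∁p∣≡n∸∣p∣ p)

x∈p─q⇒x∉q : ∀ {x} (p q : Subset N) → x ∈ p ─ q → ¬ x ∈ q
x∈p─q⇒x∉q (_ ∷ p) (inside  ∷ q) (there i) (there j) = x∈p─q⇒x∉q p q i j
x∈p─q⇒x∉q (_ ∷ p) (outside ∷ q) (there i) (there j) = x∈p─q⇒x∉q p q i j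

⊆─⁺ : {x U y : Subset N} → y ⊆ U → Disjoint x y → y ⊆ U ─ x
⊆─⁺ y⊆U x∥y i∈y = x∈p∧x∉q⇒x∈p─q (y⊆U i∈y) λ i∈x → x∥y (_ , x∈p∩q⁺ (i∈x , i∈y))

⊆─⇒⊆ : {x U y : Subset N} → y ⊆ U ─ x → y ⊆ U
⊆─⇒⊆ {x = x} {U} y⊆ i∈y = p─q⊆p U x (y⊆ i∈y)

⊆─⇒disjoint : {x U y : Subset N} → y ⊆ U ─ x → Disjoint x y
⊆─⇒disjoint {x = x} {U} {y} y⊆ (i , i∈) =
  let i∈x , i∈y = x∈p∩q⁻ x y i∈ in x∈p─q⇒x∉q U x (y⊆ i∈y) i∈x

disjoint-sym : {x y : Subset N} → Disjoint x y → Disjoint y x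
disjoint-sym {x = x} {y} x∥y (i , i∈) = x∥y (i , x∈p∩q⁺ (swap (x∈p∩q⁻ y x i∈)))

⋃-lub : {𝓑 : Family N} {U : Subset N} → All (_⊆ U) 𝓑 → ⋃ 𝓑 ⊆ U
⋃-lub []                        i∈ = ⊥-elim (∉⊥ i∈)
⋃-lub {𝓑 = p ∷ 𝓑} (p⊆U ∷ 𝓑⊆U) i∈ = [ p⊆U , ⋃-lub 𝓑⊆U ]′ (x∈p∪q⁻ p (⋃ 𝓑) i∈)

-- A block is disjoint from the union of the later ones, so its witness of nonemptiness enlarges
-- that union. This places the number of bad components within the inner range `m ≤ j`.
length≤∣⋃∣ : {𝓑 : Family N} → All Nonempty 𝓑 → AllPairs Disjoint 𝓑 → length 𝓑 ≤ ∣ ⋃ 𝓑 ∣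
length≤∣⋃∣ []  [] = z≤n
length≤∣⋃∣ {𝓑 = p ∷ 𝓑} ((i , i∈p) ∷ ne) (p∥𝓑 ∷ disj) = ℕ.≤-<-trans (length≤∣⋃∣ ne disj)
  (p⊂q⇒∣p∣<∣q∣ (q⊆p∪q p (⋃ 𝓑) , i , p⊆p∪q (⋃ 𝓑) i∈p , λ i∈⋃ →
    ⊆─⇒disjoint {U = ⊤} (⋃-lub (All.map (⊆─⁺ ⊆⊤) p∥𝓑))
      (i , x∈p∩q⁺ (i∈p , i∈⋃))))

-- The algebra of placement operators

-- The count is an integer since it drops by one per placement, possibly below zero; truncation
-- would let surplus blocks pass for an exact fit.
Value : ℕ → Set
Value N = Subset N → ℤ → ℤ

step : Subset N → Value N → Value N
step x f U c = ι (admissible? U x) * f (U ─ x) (pred c)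

-- pack w xs is the product of the operators 1 + w x · step x for x in xs.

pack : (Subset N → ℤ) → List (Subset N) → Value N → Value N
pack w []       f U c = f U c
pack w (x ∷ xs) f U c = w x * step x (pack w xs f) U c + pack w xs f U c

step-cong : (x : Subset N) {f g : Value N} → (∀ U c → f U c ≡ g U c) → ∀ U c → step x f U c ≡ step x g U c
step-cong x f≗g U c = cong (ι (admissible? U x) *_) (f≗g (U ─ x) (pred c))

-- `a * f + g` is the shape in which `pack` applies one factor, so this law alone carries `step x`
-- across a factor.
step-linear : (x : Subset N) (a : ℤ) (f g : Value N) (U : Subset N) (c : ℤ) →
              step x (λ V d → a * f V d + g V d) U c ≡ a * step x f U c + step x g U c
step-linear x a f g U c = distrib (ι (admissible? U x)) a _ _
  where
  distrib : ∀ i a u v → i * (a * u + v) ≡ a * (i * u) + i * v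
  distrib = solve-∀

-- Either side tests that `x` and `y` are nonempty, disjoint and contained in `U`. The condition is
-- symmetric, so `exchange` serves in both directions.
admissible-exchange : (x y U : Subset N) →
  ι (admissible? U x) * ι (admissible? (U ─ x) y) ≡ ι (admissible? U y) * ι (admissible? (U ─ y) x)
admissible-exchange x y U = begin
  ι (admissible? U x) * ι (admissible? (U ─ x) y)    ≡⟨ ι-× _ _ ⟨
  ι (admissible? U x ×-dec admissible? (U ─ x) y)    ≡⟨ ι-cong (mk⇔ exchange exchange) _ _ ⟩
  ι (admissible? U y ×-dec admissible? (U ─ y) x)    ≡⟨ ι-× _ _ ⟩
  ι (admissible? U y) * ι (admissible? (U ─ y) x)    ∎
  where
  exchange : ∀ {x y} → Admissible U x × Admissible (U ─ x) y → Admissible U y × Admissible (U ─ y) x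
  exchange ((x≢∅ , x⊆U) , y≢∅ , y⊆) =
    (y≢∅ , ⊆─⇒⊆ y⊆) , x≢∅ , ⊆─⁺ x⊆U (disjoint-sym (⊆─⇒disjoint y⊆))

step-comm : (x y : Subset N) (f : Value N) (U : Subset N) (c : ℤ) → step x (step y f) U c ≡ step y (step x f) U c
step-comm x y f U c = begin
  i x * (ι (admissible? (U ─ x) y) * f (U ─ x ─ y) c″)  ≡⟨ ℤ.*-assoc (i x) _ _ ⟨
  i x * ι (admissible? (U ─ x) y) * f (U ─ x ─ y) c″    ≡⟨ cong₂ _*_ (admissible-exchange x y U) (cong (λ V → f V c″) (p─q─r≡p─r─q U x y)) ⟩
  i y * ι (admissible? (U ─ y) x) * f (U ─ y ─ x) c″    ≡⟨ ℤ.*-assoc (i y) _ _ ⟩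
  i y * (ι (admissible? (U ─ y) x) * f (U ─ y ─ x) c″)  ∎
  where
  c″ = pred (pred c)
  i : Subset _ → ℤ
  i z = ι (admissible? U z)

step-step : (x : Subset N) (f : Value N) (U : Subset N) (c : ℤ) → step x (step x f) U c ≡ 0ℤ
step-step x f U c = trans
  (cong (λ z → ι (admissible? U x) * (z * f (U ─ x ─ x) (pred (pred c))))
    (ι-false (admissible? (U ─ x) x) λ ((i , i∈x) , x⊆) → x∈p─q⇒x∉q U x (x⊆ i∈x) i∈x))
  (ℤ.*-zeroʳ (ι (admissible? U x)))

pack-cong : {v w : Subset N → ℤ} → v ≗ w → (xs : List (Subset N)) {f g : Value N} →
            (∀ U c → f U c ≡ g U c) → ∀ U c → pack v xs f U c ≡ pack w xs g U c
pack-cong v≗w []       f≗g U c = f≗g U c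
pack-cong v≗w (x ∷ xs) f≗g U c =
  cong₂ _+_ (cong₂ _*_ (v≗w x) (step-cong x (pack-cong v≗w xs f≗g) U c)) (pack-cong v≗w xs f≗g U c)

pack-linear : (w : Subset N → ℤ) (xs : List (Subset N)) (a : ℤ) (f g : Value N) (U : Subset N) (c : ℤ) →
              pack w xs (λ V d → a * f V d + g V d) U c ≡ a * pack w xs f U c + pack w xs g U c
pack-linear w []       a f g U c = refl
pack-linear w (x ∷ xs) a f g U c = begin
  w x * step x (pack w xs (λ V d → a * f V d + g V d)) U c + pack w xs (λ V d → a * f V d + g V d) U c
    ≡⟨ cong₂ (λ s t → w x * s + t)
         (trans (step-cong x (pack-linear w xs a f g) U c) (step-linear x a (pack w xs f) (pack w xs g) U c))
         (pack-linear w xs a f g U c) ⟩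
  w x * (a * step x (pack w xs f) U c + step x (pack w xs g) U c) + (a * pack w xs f U c + pack w xs g U c)
    ≡⟨ regroup (w x) a _ _ _ _ ⟩
  a * (w x * step x (pack w xs f) U c + pack w xs f U c) + (w x * step x (pack w xs g) U c + pack w xs g U c) ∎
  where
  regroup : ∀ b a s t p q → b * (a * s + t) + (a * p + q) ≡ a * (b * s + p) + (b * t + q)
  regroup = solve-∀

-- Every factor is linear in an operator that commutes with `step x`, so `step x` moves outward one
-- factor at a time.
pack-step : (w : Subset N → ℤ) (xs : List (Subset N)) (x : Subset N) (f : Value N) (U : Subset N) (c : ℤ) →
            pack w xs (step x f) U c ≡ step x (pack w xs f) U c
pack-step w []       x f U c = refl
pack-step w (y ∷ ys) x f U c = begin
  w y * step y (pack w ys (step x f)) U c + pack w ys (step x f) U c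
    ≡⟨ cong₂ (λ s t → w y * s + t) (trans (step-cong y (pack-step w ys x f) U c) (step-comm y x (pack w ys f) U c)) (pack-step w ys x f U c) ⟩
  w y * step x (step y (pack w ys f)) U c + step x (pack w ys f) U c
    ≡⟨ step-linear x (w y) (step y (pack w ys f)) (pack w ys f) U c ⟨
  step x (pack w (y ∷ ys) f) U c ∎

-- By `inner`, the factor `1 + w x · step x` moves outward through the `v`-factors of the tail until
-- it meets `1 + v x · step x`. In their product the term with `step x` twice is zero, which leaves
-- the coefficient `v x + w x`.
pack-merge : (v w : Subset N → ℤ) (xs : List (Subset N)) (f : Value N) (U : Subset N) (c : ℤ) →
             pack v xs (pack w xs f) U c ≡ pack (λ x → v x + w x) xs f U c
pack-merge v w []       f U c = refl
pack-merge {N} v w (x ∷ xs) f U c = begin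
  v x * step x (pack v xs (pack w (x ∷ xs) f)) U c + pack v xs (pack w (x ∷ xs) f) U c
    ≡⟨ cong₂ (λ s t → v x * s + t) (step-cong x inner U c) (inner U c) ⟩
  v x * step x (λ V d → w x * step x h V d + h V d) U c + (w x * step x h U c + h U c)
    ≡⟨ cong (λ s → v x * s + (w x * step x h U c + h U c))
         (trans (step-linear x (w x) (step x h) h U c)
           (trans (cong (λ z → w x * z + step x h U c) (step-step x h U c)) (kill (w x) (step x h U c)))) ⟩
  v x * step x h U c + (w x * step x h U c + h U c)
    ≡⟨ regroup (v x) (w x) (step x h U c) (h U c) ⟩
  (v x + w x) * step x h U c + h U c ∎
  where
  h : Value N
  h = pack (λ y → v y + w y) xs f

  inner : ∀ U c → pack v xs (pack w (x ∷ xs) f) U c ≡ w x * step x h U c + h U c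
  inner U c = begin
    pack v xs (pack w (x ∷ xs) f) U c
      ≡⟨ pack-linear v xs (w x) (step x (pack w xs f)) (pack w xs f) U c ⟩
    w x * pack v xs (step x (pack w xs f)) U c + pack v xs (pack w xs f) U c
      ≡⟨ cong₂ (λ s t → w x * s + t)
           (trans (pack-step v xs x (pack w xs f) U c) (step-cong x (pack-merge v w xs f) U c))
           (pack-merge v w xs f U c) ⟩
    w x * step x h U c + h U c ∎

  kill : ∀ a s → a * 0ℤ + s ≡ s
  kill = solve-∀

  regroup : ∀ a b s t → a * s + (b * s + t) ≡ (a + b) * s + t
  regroup = solve-∀

pack-++ : (w : Subset N → ℤ) (xs ys : List (Subset N)) (f : Value N) (U : Subset N) (c : ℤ) →
          pack w (xs ++ ys) f U c ≡ pack w xs (pack w ys f) U c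
pack-++ w []       ys f U c = refl
pack-++ w (x ∷ xs) ys f U c =
  cong₂ (λ s t → w x * s + t) (step-cong x (pack-++ w xs ys f) U c) (pack-++ w xs ys f U c)

-- Expansion over families

Packing : Subset N → Family N → Set
Packing U 𝓑 = All (Admissible U) 𝓑 × AllPairs Disjoint 𝓑

packing? : (U : Subset N) → Decidable (Packing U)
packing? U 𝓑 = All.all? (admissible? U) 𝓑 ×-dec allPairs? disjoint? 𝓑

-- Turns pairwise disjointness into the sequential test made by iterated steps: each block must fit
-- into what the earlier ones left.
packing-∷ : (U x : Subset N) (𝓑 : Family N) → Packing U (x ∷ 𝓑) ⇔ (Admissible U x × Packing (U ─ x) 𝓑)
packing-∷ U x 𝓑 = mk⇔
  (λ { (ax ∷ a𝓑 , x∥𝓑 ∷ disj) → ax , All.zipWith shrink (a𝓑 , x∥𝓑) , disj })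
  (λ { (ax , a𝓑 , disj) → ax ∷ All.map grow a𝓑 , All.map avoid a𝓑 ∷ disj })
  where
  shrink : ∀ {y} → Admissible U y × Disjoint x y → Admissible (U ─ x) y
  shrink ((ne , y⊆U) , x∥y) = ne , ⊆─⁺ y⊆U x∥y

  grow : ∀ {y} → Admissible (U ─ x) y → Admissible U y
  grow (ne , y⊆) = ne , ⊆─⇒⊆ y⊆

  avoid : ∀ {y} → Admissible (U ─ x) y → Disjoint x y
  avoid (_ , y⊆) = ⊆─⇒disjoint y⊆

weight : (Subset N → ℤ) → Family N → ℤ
weight w []      = 1ℤ
weight w (x ∷ 𝓑) = w x * weight w 𝓑

-- The monomial of the expanded product that takes the `step` part of the factors at the members of
-- `𝓑` and the `1` of all others.
term : (Subset N → ℤ) → Value N → Subset N → ℤ → Family N → ℤ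
term w f U c 𝓑 = ι (packing? U 𝓑) * (weight w 𝓑 * f (U ─ ⋃ 𝓑) (c - + length 𝓑))

term-∷ : (w : Subset N → ℤ) (f : Value N) (U : Subset N) (c : ℤ) (x : Subset N) (𝓑 : Family N) →
         term w f U c (x ∷ 𝓑) ≡ w x * (ι (admissible? U x) * term w f (U ─ x) (pred c) 𝓑)
term-∷ w f U c x 𝓑 = begin
  ι (packing? U (x ∷ 𝓑)) * (w x * weight w 𝓑 * f (U ─ (x ∪ ⋃ 𝓑)) (c - + suc (length 𝓑)))
    ≡⟨ cong₂ (λ i r → i * (w x * weight w 𝓑 * r))
         (trans (ι-cong (packing-∷ U x 𝓑) _ (admissible? U x ×-dec packing? (U ─ x) 𝓑)) (ι-× _ _))
         (cong₂ f (sym (p─q─r≡p─q∪r U x (⋃ 𝓑)))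
            (trans (ℤ.minus-suc c (length 𝓑)) (sym (ℤ.pred-+ c (- + length 𝓑))))) ⟩
  ι (admissible? U x) * ι (packing? (U ─ x) 𝓑) * (w x * weight w 𝓑 * r′)
    ≡⟨ regroup (ι (admissible? U x)) (ι (packing? (U ─ x) 𝓑)) (w x) (weight w 𝓑) r′ ⟩
  w x * (ι (admissible? U x) * (ι (packing? (U ─ x) 𝓑) * (weight w 𝓑 * r′))) ∎
  where
  r′ = f (U ─ x ─ ⋃ 𝓑) (pred c - + length 𝓑)
  regroup : ∀ a b c d e → a * b * (c * d * e) ≡ c * (a * (b * (d * e)))
  regroup = solve-∀

-- Multiplying out: taking `step x` or `1` in the head factor corresponds to the sublists with and
-- without `x`.
pack-expand : (w : Subset N → ℤ) (xs : List (Subset N)) (f : Value N) (U : Subset N) (c : ℤ) →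
              pack w xs f U c ≡ ∑[ 𝓑 ∈ sublists xs ] term w f U c 𝓑
pack-expand w [] f U c = begin
  f U c                                    ≡⟨ cong₂ f (sym (p─⊥≡p U)) (sym (ℤ.+-identityʳ c)) ⟩
  f (U ─ ⊥) (c - + 0)                      ≡⟨ unit (f (U ─ ⊥) (c - + 0)) ⟩
  1ℤ * (1ℤ * f (U ─ ⊥) (c - + 0)) + 0ℤ     ≡⟨ cong (λ i → i * (1ℤ * f (U ─ ⊥) (c - + 0)) + 0ℤ) (ι-true (packing? U []) ([] , [])) ⟨
  term w f U c [] + 0ℤ                     ∎
  where
  unit : ∀ a → a ≡ 1ℤ * (1ℤ * a) + 0ℤ
  unit = solve-∀
pack-expand w (x ∷ xs) f U c = begin
  w x * (ι (admissible? U x) * pack w xs f (U ─ x) (pred c)) + pack w xs f U c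
    ≡⟨ cong₂ (λ s t → w x * (ι (admissible? U x) * s) + t) (pack-expand w xs f (U ─ x) (pred c)) (pack-expand w xs f U c) ⟩
  w x * (ι (admissible? U x) * ∑[ 𝓑 ∈ sublists xs ] term w f (U ─ x) (pred c) 𝓑) + rest
    ≡⟨ cong (λ s → w x * s + rest) (*-distribˡ-∑∈ (ι (admissible? U x)) (sublists xs) _) ⟩
  w x * (∑[ 𝓑 ∈ sublists xs ] (ι (admissible? U x) * term w f (U ─ x) (pred c) 𝓑)) + rest
    ≡⟨ cong (_+ rest) (*-distribˡ-∑∈ (w x) (sublists xs) _) ⟩
  ∑[ 𝓑 ∈ sublists xs ] (w x * (ι (admissible? U x) * term w f (U ─ x) (pred c) 𝓑)) + rest
    ≡⟨ cong (_+ rest) (∑∈-cong (sublists xs) (λ 𝓑 → sym (term-∷ w f U c x 𝓑))) ⟩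
  ∑[ 𝓑 ∈ sublists xs ] term w f U c (x ∷ 𝓑) + rest
    ≡⟨ cong (_+ rest) (∑∈-map (x ∷_) (sublists xs) (term w f U c)) ⟨
  ∑[ 𝓑 ∈ map (x ∷_) (sublists xs) ] term w f U c 𝓑 + rest
    ≡⟨ ∑∈-++ (map (x ∷_) (sublists xs)) (sublists xs) (term w f U c) ⟨
  ∑[ 𝓑 ∈ sublists (x ∷ xs) ] term w f U c 𝓑 ∎
  where
  rest = ∑[ 𝓑 ∈ sublists xs ] term w f U c 𝓑

-- The scalar serves two purposes: `1ℤ` for partitions with blocks restricted by `Q`, and `-1ℤ` for
-- the signs attached to bad components.
weight-ι : {Q : Pred (Subset N) 0ℓ} (a : ℤ) (Q? : Decidable Q) (𝓑 : Family N) →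
           weight (λ x → a * ι (Q? x)) 𝓑 ≡ a ^ length 𝓑 * ι (All.all? Q? 𝓑)
weight-ι a Q? []      = trans (sym (ι-true (All.all? Q? []) [])) (sym (ℤ.*-identityˡ _))
weight-ι a Q? (x ∷ 𝓑) = begin
  a * ι (Q? x) * weight (λ x → a * ι (Q? x)) 𝓑        ≡⟨ cong (a * ι (Q? x) *_) (weight-ι a Q? 𝓑) ⟩
  a * ι (Q? x) * (a ^ length 𝓑 * ι (All.all? Q? 𝓑))   ≡⟨ regroup a (ι (Q? x)) (a ^ length 𝓑) _ ⟩
  a * a ^ length 𝓑 * (ι (Q? x) * ι (All.all? Q? 𝓑))   ≡⟨ cong (a * a ^ length 𝓑 *_) all-∷ ⟩
  a ^ suc (length 𝓑) * ι (All.all? Q? (x ∷ 𝓑))        ∎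
  where
  all-∷ : ι (Q? x) * ι (All.all? Q? 𝓑) ≡ ι (All.all? Q? (x ∷ 𝓑))
  all-∷ = trans (sym (ι-× (Q? x) (All.all? Q? 𝓑)))
                (ι-cong (mk⇔ (uncurry _∷_) λ { (q ∷ qs) → q , qs }) _ _)
  regroup : ∀ a b c d → a * b * (c * d) ≡ a * c * (b * d)
  regroup = solve-∀

-- Partitions

-- Evaluated after all placements, it accepts those that cover everything with exactly the
-- prescribed number of blocks.
δ : Value N
δ U c = ι (≡-dec _≟ᵇ_ U ⊥ ×-dec c ℤ.≟ 0ℤ)

-- partitions U c is the number of partitions of U into c blocks.

partitions : Value N
partitions = pack (λ _ → 1ℤ) (subsets _) δ

-- Connectivity as `Q` yields compositions, a `Q` that always holds yields Stirling numbers. In the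
-- expansion, `δ` keeps the packings of `⊤` whose union is `⊤` and whose length is `k`.
pack-partitions : {P : Pred (Family N) 0ℓ} {Q : Pred (Subset N) 0ℓ} (P? : Decidable P) (Q? : Decidable Q) (k : ℕ) →
  (∀ 𝓟 → P 𝓟 ⇔ (IsPartition ⊤ 𝓟 × All Q 𝓟 × length 𝓟 ≡ k)) →
  + countFamilies P? ≡ pack (λ x → 1ℤ * ι (Q? x)) (subsets N) δ ⊤ (+ k)
pack-partitions {N} {P} {Q} P? Q? k P⇔ = begin
  + countFamilies P?                             ≡⟨ length-filter P? (families N) ⟩
  ∑[ 𝓟 ∈ families N ] ι (P? 𝓟)                   ≡⟨ ∑∈-cong (families N) summand ⟩
  ∑[ 𝓟 ∈ families N ] term w δ ⊤ (+ k) 𝓟         ≡⟨ pack-expand w (subsets N) δ ⊤ (+ k) ⟨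
  pack w (subsets N) δ ⊤ (+ k)                   ∎
  where
  w : Subset N → ℤ
  w x = 1ℤ * ι (Q? x)

  complement-⊥ : (p : Subset N) → ⊤ ─ p ≡ ⊥ → p ≡ ⊤
  complement-⊥ p eq = ⊆-antisym ⊆⊤ λ {i} _ → decidable-stable (i ∈? p)
    λ i∉p → ∉⊥ (subst (i ∈_) eq (x∈p∧x∉q⇒x∈p─q ∈⊤ i∉p))

  summand : ∀ 𝓟 → ι (P? 𝓟) ≡ term w δ ⊤ (+ k) 𝓟
  summand 𝓟 = begin
    ι (P? 𝓟)
      ≡⟨ ι-cong equiv _ _ ⟩
    ι (packing? ⊤ 𝓟 ×-dec All.all? Q? 𝓟 ×-dec d)
      ≡⟨ trans (ι-× (packing? ⊤ 𝓟) _) (cong (ι (packing? ⊤ 𝓟) *_) (ι-× (All.all? Q? 𝓟) d)) ⟩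
    ι (packing? ⊤ 𝓟) * (ι (All.all? Q? 𝓟) * ι d)
      ≡⟨ cong (λ z → ι (packing? ⊤ 𝓟) * (z * ι d)) (trans (weight-ι 1ℤ Q? 𝓟)
           (trans (cong (_* ι (All.all? Q? 𝓟)) (ℤ.^-zeroˡ (length 𝓟))) (ℤ.*-identityˡ _))) ⟨
    term w δ ⊤ (+ k) 𝓟 ∎
    where
    d = ≡-dec _≟ᵇ_ (⊤ ─ ⋃ 𝓟) ⊥ ×-dec (+ k - + length 𝓟) ℤ.≟ 0ℤ
    equiv : P 𝓟 ⇔ (Packing ⊤ 𝓟 × All Q 𝓟 × ⊤ ─ ⋃ 𝓟 ≡ ⊥ × + k - + length 𝓟 ≡ 0ℤ)
    equiv = mk⇔
      (λ p → let (ne , disj , ⋃≡⊤) , all , len = to (P⇔ 𝓟) p in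
        (All.map admissible-⊤ ne , disj) , all ,
        trans (cong (⊤ ─_) ⋃≡⊤) (p─⊤≡⊥ ⊤) , ℤ.i≡j⇒i-j≡0 (cong +_ (sym len)))
      (λ ((adm , disj) , all , eq , len) → from (P⇔ 𝓟)
        ((All.map proj₁ adm , disj , complement-⊥ (⋃ 𝓟) eq) , all ,
         sym (ℤ.+-injective (ℤ.i-j≡0⇒i≡j (+ k) (+ length 𝓟) len))))

-- Stirling numbers

-- Placing a block only lowers the count, so from a negative one `f` is evaluated at negative counts
-- only.
pack-negative : (w : Subset N → ℤ) (xs : List (Subset N)) {f : Value N} → (∀ U n → f U -[1+ n ] ≡ 0ℤ) →
                ∀ U n → pack w xs f U -[1+ n ] ≡ 0ℤ
pack-negative w []       f≡0 U n = f≡0 U n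
pack-negative w (x ∷ xs) f≡0 U n = trans
  (cong₂ (λ s t → w x * (ι (admissible? U x) * s) + t)
    (pack-negative w xs f≡0 (U ─ x) (suc n)) (pack-negative w xs f≡0 U n))
  (vanish (w x) (ι (admissible? U x)))
  where
  vanish : ∀ a b → a * (b * 0ℤ) + 0ℤ ≡ 0ℤ
  vanish = solve-∀

partitions-negative : (U : Subset N) (n : ℕ) → partitions U -[1+ n ] ≡ 0ℤ
partitions-negative {N} = pack-negative _ (subsets N) λ U n → ι-false _ λ ()

-- No block here contains the first element, so its side `s` reaches `f` unchanged.
pack-outside : (xs : List (Subset N)) (f : Value (suc N)) (s : Side) (U : Subset N) (c : ℤ) →
  pack (λ _ → 1ℤ) (map (outside ∷_) xs) f (s ∷ U) c ≡ pack (λ _ → 1ℤ) xs (f ∘ (s ∷_)) U c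
pack-outside []       f s U c = refl
pack-outside (x ∷ xs) f s U c = cong₂ (λ i t → 1ℤ * i + t)
  (cong₂ _*_ (ι-cong (mk⇔ outside⁻ outside⁺) _ _) (pack-outside xs f s (U ─ x) (pred c)))
  (pack-outside xs f s U c)
  where
  outside⁻ : Admissible (s ∷ U) (outside ∷ x) → Admissible U x
  outside⁻ ((_ , there i∈x) , x⊆U) = (_ , i∈x) , drop-∷-⊆ x⊆U

  outside⁺ : Admissible U x → Admissible (s ∷ U) (outside ∷ x)
  outside⁺ ((_ , i∈x) , x⊆U) = (_ , there i∈x) , out⊆ x⊆U

-- Once the first element is covered, no block through it fits, and every factor acts as the
-- identity.
pack-inside-outside : (xs : List (Subset N)) (f : Value (suc N)) (U : Subset N) (c : ℤ) →
  pack (λ _ → 1ℤ) (map (inside ∷_) xs) f (outside ∷ U) c ≡ f (outside ∷ U) c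
pack-inside-outside []       f U c = refl
pack-inside-outside (x ∷ xs) f U c = trans
  (cong₂ (λ i t → 1ℤ * (i * pack (λ _ → 1ℤ) (map (inside ∷_) xs) f (outside ∷ (U ─ x)) (pred c)) + t)
    (ι-false (admissible? (outside ∷ U) (inside ∷ x)) λ (_ , x⊆U) → case x⊆U here of λ ())
    (pack-inside-outside xs f U c))
  (ℤ.+-identityˡ _)

-- All these blocks share the first element, so at most one is placed. That element already makes
-- the block nonempty; only the remainder `x`, possibly empty, has to fit into `U`.
pack-inside-inside : (xs : List (Subset N)) (f : Value (suc N)) (U : Subset N) (c : ℤ) →
  pack (λ _ → 1ℤ) (map (inside ∷_) xs) f (inside ∷ U) c ≡
  ∑[ x ∈ xs ] (ι (x ⊆? U) * f (outside ∷ (U ─ x)) (pred c)) + f (inside ∷ U) c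
pack-inside-inside []       f U c = sym (ℤ.+-identityˡ _)
pack-inside-inside (x ∷ xs) f U c = trans
  (cong₂ _+_
    (trans (ℤ.*-identityˡ _)
      (cong₂ _*_ (ι-cong (mk⇔ inside⁻ inside⁺) (admissible? (inside ∷ U) (inside ∷ x)) (x ⊆? U)) (pack-inside-outside xs f (U ─ x) (pred c))))
    (pack-inside-inside xs f U c))
  (sym (ℤ.+-assoc (ι (x ⊆? U) * f (outside ∷ (U ─ x)) (pred c)) _ _))
  where
  inside⁻ : Admissible (inside ∷ U) (inside ∷ x) → x ⊆ U
  inside⁻ (_ , x⊆U) = drop-∷-⊆ x⊆U

  inside⁺ : x ⊆ U → Admissible (inside ∷ U) (inside ∷ x)
  inside⁺ x⊆U = (_ , here) , s⊆s x⊆U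

partitions-outside : (U : Subset N) (c : ℤ) → partitions (outside ∷ U) c ≡ partitions U c
partitions-outside {N} U c = begin
  partitions (outside ∷ U) c
    ≡⟨ pack-++ _ (map (inside ∷_) (subsets N)) (map (outside ∷_) (subsets N)) δ (outside ∷ U) c ⟩
  pack _ (map (inside ∷_) (subsets N)) (pack _ (map (outside ∷_) (subsets N)) δ) (outside ∷ U) c
    ≡⟨ pack-inside-outside (subsets N) _ U c ⟩
  pack _ (map (outside ∷_) (subsets N)) δ (outside ∷ U) c
    ≡⟨ pack-outside (subsets N) δ outside U c ⟩
  pack _ (subsets N) (δ ∘ (outside ∷_)) U c
    ≡⟨ pack-cong (λ _ → refl) (subsets N) (λ V d → ι-cong
         (mk⇔ (λ { (refl , d≡0) → refl , d≡0 }) λ { (refl , d≡0) → refl , d≡0 }) _ _) U c ⟩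
  partitions U c ∎

-- Classifies partitions by the block through the first element; `x` is the rest of that block.
partitions-inside : (U : Subset N) (c : ℤ) →
  partitions (inside ∷ U) c ≡ ∑[ x ∈ subsets N ] (ι (x ⊆? U) * partitions (U ─ x) (pred c))
partitions-inside {N} U c = begin
  partitions (inside ∷ U) c
    ≡⟨ pack-++ _ (map (inside ∷_) (subsets N)) (map (outside ∷_) (subsets N)) δ (inside ∷ U) c ⟩
  pack _ (map (inside ∷_) (subsets N)) rest (inside ∷ U) c
    ≡⟨ pack-inside-inside (subsets N) rest U c ⟩
  ∑[ x ∈ subsets N ] (ι (x ⊆? U) * rest (outside ∷ (U ─ x)) (pred c)) + rest (inside ∷ U) c
    ≡⟨ cong₂ _+_
         (∑∈-cong (subsets N) λ x → cong (ι (x ⊆? U) *_)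
           -- With the first element covered, blocks through it act trivially; putting them back
           -- into the product turns `rest` into `partitions`.
           (trans (sym (pack-inside-outside (subsets N) rest (U ─ x) (pred c)))
             (trans (sym (pack-++ _ (map (inside ∷_) (subsets N)) (map (outside ∷_) (subsets N)) δ (outside ∷ (U ─ x)) (pred c)))
               (partitions-outside (U ─ x) (pred c)))))
         uncovered ⟩
  ∑[ x ∈ subsets N ] (ι (x ⊆? U) * partitions (U ─ x) (pred c)) + 0ℤ
    ≡⟨ ℤ.+-identityʳ _ ⟩
  ∑[ x ∈ subsets N ] (ι (x ⊆? U) * partitions (U ─ x) (pred c)) ∎
  where
  rest : Value (suc N)
  rest = pack (λ _ → 1ℤ) (map (outside ∷_) (subsets N)) δ

  -- The blocks in `rest` all miss the first element, which therefore stays uncovered, and `δ`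
  -- vanishes.
  uncovered : rest (inside ∷ U) c ≡ 0ℤ
  uncovered = begin
    rest (inside ∷ U) c                              ≡⟨ pack-outside (subsets N) δ inside U c ⟩
    pack _ (subsets N) (δ ∘ (inside ∷_)) U c         ≡⟨ pack-cong (λ _ → refl) (subsets N) (λ V d → ι-false _ λ ()) U c ⟩
    pack _ (subsets N) (λ _ _ → 0ℤ) U c              ≡⟨ pack-zero (subsets N) U c ⟩
    0ℤ                                               ∎
    where
    pack-zero : (xs : List (Subset N)) (V : Subset N) (d : ℤ) → pack (λ _ → 1ℤ) xs (λ _ _ → 0ℤ) V d ≡ 0ℤ
    pack-zero []       V d = refl
    pack-zero (x ∷ xs) V d = trans
      (cong₂ (λ s t → 1ℤ * (ι (admissible? V x) * s) + t) (pack-zero xs (V ─ x) (pred d)) (pack-zero xs V d))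
      (cong (λ s → 1ℤ * s + 0ℤ) (ℤ.*-zeroʳ (ι (admissible? V x))))

∑-subsets : (f : Subset (suc N) → ℤ) →
  ∑[ x ∈ subsets (suc N) ] f x ≡ ∑[ x ∈ subsets N ] f (inside ∷ x) + ∑[ x ∈ subsets N ] f (outside ∷ x)
∑-subsets {N} f = trans (∑∈-++ (map (inside ∷_) (subsets N)) _ f)
  (cong₂ _+_ (∑∈-map (inside ∷_) (subsets N) f) (∑∈-map (outside ∷_) (subsets N) f))

-- An element outside `U` cannot lie in `x`. An element of `U` may or may not; if it does not, it
-- stays in the difference, hence `g ∘ suc`. Testing `x ⊆? ⊤` gives the right side the form of the
-- left, so `split` serves both.
∑-⊆-cardinality : (g : ℕ → ℤ) (U : Subset N) →
  ∑[ x ∈ subsets N ] (ι (x ⊆? U) * g ∣ U ─ x ∣) ≡ ∑[ x ∈ subsets ∣ U ∣ ] (ι (x ⊆? ⊤) * g ∣ ⊤ ─ x ∣)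
∑-⊆-cardinality g [] = refl
∑-⊆-cardinality {suc N} g (outside ∷ U) = begin
  ∑[ x ∈ subsets (suc N) ] (ι (x ⊆? (outside ∷ U)) * g ∣ (outside ∷ U) ─ x ∣)
    ≡⟨ ∑-subsets (λ x → ι (x ⊆? (outside ∷ U)) * g ∣ (outside ∷ U) ─ x ∣) ⟩
  ∑[ x ∈ subsets N ] (ι ((inside ∷ x) ⊆? (outside ∷ U)) * g ∣ U ─ x ∣) +
  ∑[ x ∈ subsets N ] (ι ((outside ∷ x) ⊆? (outside ∷ U)) * g ∣ U ─ x ∣)
    ≡⟨ cong₂ _+_
         (trans (∑∈-cong (subsets N) (λ x → cong (_* g ∣ U ─ x ∣)
                  (ι-false ((inside ∷ x) ⊆? (outside ∷ U)) λ x⊆U → case x⊆U here of λ ())))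
                (∑∈-zero (subsets N)))
         (trans (∑∈-cong (subsets N) (λ x → cong (_* g ∣ U ─ x ∣)
                  (ι-cong (⇔-sym out⊆-⇔) ((outside ∷ x) ⊆? (outside ∷ U)) (x ⊆? U))))
                (∑-⊆-cardinality g U)) ⟩
  0ℤ + ∑[ x ∈ subsets ∣ U ∣ ] (ι (x ⊆? ⊤) * g ∣ ⊤ ─ x ∣)
    ≡⟨ ℤ.+-identityˡ _ ⟩
  ∑[ x ∈ subsets ∣ U ∣ ] (ι (x ⊆? ⊤) * g ∣ ⊤ ─ x ∣) ∎
∑-⊆-cardinality {suc N} g (inside ∷ U) = begin
  ∑[ x ∈ subsets (suc N) ] (ι (x ⊆? (inside ∷ U)) * g ∣ (inside ∷ U) ─ x ∣)
    ≡⟨ split U ⟩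
  ∑[ x ∈ subsets N ] (ι (x ⊆? U) * g ∣ U ─ x ∣) + ∑[ x ∈ subsets N ] (ι (x ⊆? U) * g (suc ∣ U ─ x ∣))
    ≡⟨ cong₂ _+_ (∑-⊆-cardinality g U) (∑-⊆-cardinality (g ∘ suc) U) ⟩
  ∑[ x ∈ subsets ∣ U ∣ ] (ι (x ⊆? ⊤) * g ∣ ⊤ ─ x ∣) + ∑[ x ∈ subsets ∣ U ∣ ] (ι (x ⊆? ⊤) * g (suc ∣ ⊤ ─ x ∣))
    ≡⟨ split (⊤ {∣ U ∣}) ⟨
  ∑[ x ∈ subsets (suc ∣ U ∣) ] (ι (x ⊆? ⊤) * g ∣ ⊤ ─ x ∣) ∎
  where
  split : ∀ {M} (V : Subset M) →
    ∑[ x ∈ subsets (suc M) ] (ι (x ⊆? (inside ∷ V)) * g ∣ (inside ∷ V) ─ x ∣) ≡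
    ∑[ x ∈ subsets M ] (ι (x ⊆? V) * g ∣ V ─ x ∣) + ∑[ x ∈ subsets M ] (ι (x ⊆? V) * g (suc ∣ V ─ x ∣))
  split {M} V = trans (∑-subsets (λ x → ι (x ⊆? (inside ∷ V)) * g ∣ (inside ∷ V) ─ x ∣)) (cong₂ _+_
    (∑∈-cong (subsets M) λ x → cong (_* g ∣ V ─ x ∣)
      (ι-cong (⇔-sym in⊆in-⇔) ((inside ∷ x) ⊆? (inside ∷ V)) (x ⊆? V)))
    (∑∈-cong (subsets M) λ x → cong (_* g (suc ∣ V ─ x ∣))
      (ι-cong (⇔-sym out⊆-⇔) ((outside ∷ x) ⊆? (inside ∷ V)) (x ⊆? V))))

-- Induction on the count, then on the set: `U ─ x` in the recurrence is not structurally smaller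
-- than `inside ∷ U`, but the count has dropped. An `outside` entry keeps the count and shortens the
-- set.
partitions-cardinality : (c : ℤ) (U : Subset N) → partitions U c ≡ partitions (⊤ {∣ U ∣}) c
partitions-cardinality -[1+ c ] U             = trans (partitions-negative U c) (sym (partitions-negative (⊤ {∣ U ∣}) c))
partitions-cardinality (+ c)    []            = refl
partitions-cardinality (+ c)    (outside ∷ U) = trans (partitions-outside U (+ c)) (partitions-cardinality (+ c) U)
partitions-cardinality {suc N} (+ c) (inside ∷ U) = begin
  partitions (inside ∷ U) (+ c)                                                         ≡⟨ reduce U ⟩
  ∑[ x ∈ subsets N ] (ι (x ⊆? U) * partitions (⊤ {∣ U ─ x ∣}) (pred (+ c)))             ≡⟨ ∑-⊆-cardinality (λ a → partitions (⊤ {a}) (pred (+ c))) U ⟩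
  ∑[ x ∈ subsets ∣ U ∣ ] (ι (x ⊆? ⊤) * partitions (⊤ {∣ ⊤ ─ x ∣}) (pred (+ c)))         ≡⟨ reduce (⊤ {∣ U ∣}) ⟨
  partitions (⊤ {suc ∣ U ∣}) (+ c)                                                      ∎
  where
  -- From count zero the predecessor is negative, where both sides vanish; otherwise it is a smaller
  -- natural number.
  smaller : ∀ {M} c (V : Subset M) → partitions V (pred (+ c)) ≡ partitions (⊤ {∣ V ∣}) (pred (+ c))
  smaller zero    V = partitions-cardinality -[1+ 0 ] V
  smaller (suc c) V = partitions-cardinality (+ c) V

  reduce : ∀ {M} (V : Subset M) → partitions (inside ∷ V) (+ c) ≡
    ∑[ x ∈ subsets M ] (ι (x ⊆? V) * partitions (⊤ {∣ V ─ x ∣}) (pred (+ c)))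
  reduce {M} V = trans (partitions-inside V (+ c))
    (∑∈-cong (subsets M) λ x → cong (ι (x ⊆? V) *_) (smaller c (V ─ x)))

S-partitions : (a : ℕ) (c : ℤ) → + S a c ≡ partitions (⊤ {a}) c
S-partitions a -[1+ c ] = sym (partitions-negative (⊤ {a}) c)
S-partitions a (+ c)    = trans
  (pack-partitions {a} _ (λ _ → yes tt) c λ 𝓟 →
    mk⇔ (λ (part , len) → part , All.universal (λ _ → tt) 𝓟 , len) (λ (part , _ , len) → part , len))
  (pack-cong (λ _ → trans (ℤ.*-identityˡ _) (ι-true (yes tt) tt)) (subsets a) (λ _ _ → refl) ⊤ (+ c))

-- Bad components

-- A vertex of `x` outside `V G` is adjacent in `K⁻ G` to all other vertices, so it connects `x`,
-- which is then not bad. If `x ⊆ V G`, then `K⁻ G` and `complement G` have the same edges on `x`.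
connected⇔¬bad : (G : Graph N) (x : Subset N) → Connected (induced (K⁻ G) x) ⇔ (¬ Bad G x)
connected⇔¬bad G x = mk⇔ connected⇒¬bad ¬bad⇒connected
  where
  connected⇒¬bad : Connected (induced (K⁻ G) x) → ¬ Bad G x
  connected⇒¬bad conn (_ , x⊆V , disconnected) = disconnected λ u v u∈ v∈ →
    gmap id (λ { ((u≢v , ¬uv) , u∈x , v∈x) → ((x⊆V u∈x , x⊆V v∈x) , u≢v , ¬uv) , u∈x , v∈x })
      (conn u v (x∈p∩q⁺ (∈⊤ , proj₂ (x∈p∩q⁻ (V G) x u∈))) (x∈p∩q⁺ (∈⊤ , proj₂ (x∈p∩q⁻ (V G) x v∈))))

  ¬bad⇒connected : ¬ Bad G x → Connected (induced (K⁻ G) x)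
  ¬bad⇒connected ¬bad u v u∈ v∈ with any? (λ w → (w ∈? x) ×-dec ¬? (w ∈? V G))
  ... | yes (w , w∈x , w∉V) = to-w ◅◅ reverse (symm (induced (K⁻ G) x)) from-w
    where
    path : ∀ {z} → z ∈ V (induced (K⁻ G) x) → Star (Adj (induced (K⁻ G) x)) z w
    path {z} z∈ with z ≟ w
    ... | yes refl = ε
    ... | no z≢w   = ((z≢w , w∉V ∘ Adj⇒∈V G ∘ symm G) , proj₂ (x∈p∩q⁻ ⊤ x z∈) , w∈x) ◅ ε
    to-w   = path u∈
    from-w = path v∈
  ... | no ∄w = gmap id (λ { ((_ , u≢v , ¬uv) , uv∈x) → (u≢v , ¬uv) , uv∈x })
      -- The endpoint `u` shows that `x` is nonempty, so a disconnected complement would make `x`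
      -- bad.
      (decidable-stable (connected? (induced (complement G) x)) (λ disconnected → ¬bad ((u , u∈x) , x⊆V , disconnected))
        u v (x∈p∩q⁺ (x⊆V u∈x , u∈x)) (x∈p∩q⁺ (x⊆V v∈x , v∈x)))
    where
    x⊆V : x ⊆ V G
    x⊆V {w} w∈x = decidable-stable (w ∈? V G) λ w∉V → ∄w (w , w∈x , w∉V)
    u∈x = proj₂ (x∈p∩q⁻ ⊤ x u∈)
    v∈x = proj₂ (x∈p∩q⁻ ⊤ x v∈)

-- The right side is a sum `v x + w x` of the kind that `pack-merge` splits, with `w x` equal to
-- one.
ι-¬ : (p : Dec P) (q : Dec Q) → P ⇔ (¬ Q) → ι p ≡ -1ℤ * ι q + 1ℤ
ι-¬ p (yes q) P⇔¬Q = trans (ι-false p λ x → to P⇔¬Q x q) (cong (λ i → -1ℤ * i + 1ℤ) (sym (ι-true (yes q) q)))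
ι-¬ p (no ¬q) P⇔¬Q = trans (ι-true p (from P⇔¬Q ¬q)) (cong (λ i → -1ℤ * i + 1ℤ) (sym (ι-false (no ¬q) ¬q)))

-- The signed sum over families of bad components

BadFamily : Graph N → Family N → Set
BadFamily G 𝓑 = All (Bad G) 𝓑 × AllPairs Disjoint 𝓑

badFamily? : (G : Graph N) → Decidable (BadFamily G)
badFamily? G 𝓑 = All.all? (bad? G) 𝓑 ×-dec allPairs? disjoint? 𝓑

C-expansion : (G : Graph N) (k : ℕ) → + C k (K⁻ G) ≡
  ∑[ 𝓑 ∈ families N ] (ι (badFamily? G 𝓑) * (-1ℤ ^ length 𝓑 * + S (N ∸ ∣ ⋃ 𝓑 ∣) (+ k - + length 𝓑)))
C-expansion {N} G k = begin
  + C k (K⁻ G)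
    ≡⟨ pack-partitions _ (λ x → connected? (induced (K⁻ G) x)) k (λ 𝓟 →
         mk⇔ (λ ((part , conn) , len) → part , conn , len) (λ (part , conn , len) → (part , conn) , len)) ⟩
  pack (λ x → 1ℤ * ι (connected? (induced (K⁻ G) x))) (subsets N) δ ⊤ (+ k)
    ≡⟨ pack-cong (λ x → trans (ℤ.*-identityˡ _) (ι-¬ _ (bad? G x) (connected⇔¬bad G x))) (subsets N) (λ _ _ → refl) ⊤ (+ k) ⟩
  pack (λ x → -1ℤ * ι (bad? G x) + 1ℤ) (subsets N) δ ⊤ (+ k)
    -- Read from right to left, the merge separates the two weights; the inner product with weight
    -- one is `partitions` by definition.
    ≡⟨ pack-merge badness (λ _ → 1ℤ) (subsets N) δ ⊤ (+ k) ⟨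
  pack badness (subsets N) partitions ⊤ (+ k)
    ≡⟨ pack-expand badness (subsets N) partitions ⊤ (+ k) ⟩
  ∑[ 𝓑 ∈ families N ] term badness partitions ⊤ (+ k) 𝓑
    ≡⟨ ∑∈-cong (families N) summand ⟩
  ∑[ 𝓑 ∈ families N ] (ι (badFamily? G 𝓑) * (-1ℤ ^ length 𝓑 * + S (N ∸ ∣ ⋃ 𝓑 ∣) (+ k - + length 𝓑))) ∎
  where
  badness : Subset N → ℤ
  badness x = -1ℤ * ι (bad? G x)

  summand : ∀ 𝓑 → term badness partitions ⊤ (+ k) 𝓑 ≡
    ι (badFamily? G 𝓑) * (-1ℤ ^ length 𝓑 * + S (N ∸ ∣ ⋃ 𝓑 ∣) (+ k - + length 𝓑))
  summand 𝓑 = begin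
    ι (packing? ⊤ 𝓑) * (weight badness 𝓑 * partitions (⊤ ─ ⋃ 𝓑) d)
      ≡⟨ cong₂ (λ s t → ι (packing? ⊤ 𝓑) * (s * t)) (weight-ι -1ℤ (bad? G) 𝓑) stirling ⟩
    ι (packing? ⊤ 𝓑) * (-1ℤ ^ length 𝓑 * ι (All.all? (bad? G) 𝓑) * s)
      ≡⟨ regroup (ι (packing? ⊤ 𝓑)) (-1ℤ ^ length 𝓑) (ι (All.all? (bad? G) 𝓑)) s ⟩
    ι (packing? ⊤ 𝓑) * ι (All.all? (bad? G) 𝓑) * (-1ℤ ^ length 𝓑 * s)
      ≡⟨ cong (_* (-1ℤ ^ length 𝓑 * s)) (trans (sym (ι-× (packing? ⊤ 𝓑) (All.all? (bad? G) 𝓑))) (ι-cong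
           -- Bad components are nonempty, so a bad family is automatically a packing of `⊤`.
           (mk⇔ (λ ((_ , disj) , bad) → bad , disj)
                (λ (bad , disj) → (All.map (admissible-⊤ ∘ proj₁) bad , disj) , bad)) _ _)) ⟩
    ι (badFamily? G 𝓑) * (-1ℤ ^ length 𝓑 * s) ∎
    where
    d = + k - + length 𝓑
    s = + S (N ∸ ∣ ⋃ 𝓑 ∣) d

    stirling : partitions (⊤ ─ ⋃ 𝓑) d ≡ s
    stirling = trans (partitions-cardinality d (⊤ ─ ⋃ 𝓑))
      (trans (cong (λ a → partitions (⊤ {a}) d) (∣⊤─p∣≡N∸∣p∣ (⋃ 𝓑))) (sym (S-partitions (N ∸ ∣ ⋃ 𝓑 ∣) d)))

    regroup : ∀ a b c d → a * (b * c * d) ≡ a * c * (b * d)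
    regroup = solve-∀

-- A bad family is counted at exactly one pair, `j` the size of its union and `m` its length. The
-- pair is in range because the union lies in `V G` and has at least as many elements as there are
-- blocks.
∑-graded : (G : Graph N) (F : ℕ → ℕ → ℤ) (𝓑 : Family N) →
  ∑[ j ≤ ∣ V G ∣ ] ∑[ m ≤ toℕ j ] (ι (isBadFamily? G (toℕ j) (toℕ m) 𝓑) * F (toℕ j) (toℕ m)) ≡
  ι (badFamily? G 𝓑) * F ∣ ⋃ 𝓑 ∣ (length 𝓑)
∑-graded G F 𝓑 with badFamily? G 𝓑
... | no ¬bad = begin
  ∑[ j ≤ ∣ V G ∣ ] ∑[ m ≤ toℕ j ] (ι (isBadFamily? G (toℕ j) (toℕ m) 𝓑) * F (toℕ j) (toℕ m))
    ≡⟨ sum-cong-≗ {suc ∣ V G ∣} (λ j → trans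
         (sum-cong-≗ {suc (toℕ j)} (λ m → cong (_* F (toℕ j) (toℕ m))
           (ι-false (isBadFamily? G (toℕ j) (toℕ m) 𝓑) λ (bad , disj , _) → ¬bad (bad , disj))))
         (sum-replicate-zero (suc (toℕ j)))) ⟩
  ∑[ j ≤ ∣ V G ∣ ] 0ℤ
    ≡⟨ sum-replicate-zero (suc ∣ V G ∣) ⟩
  0ℤ
    ≡⟨ cong (_* F ∣ ⋃ 𝓑 ∣ (length 𝓑)) (ι-false (no ¬bad) ¬bad) ⟨
  ι (no ¬bad) * F ∣ ⋃ 𝓑 ∣ (length 𝓑) ∎
... | yes (bad , disj) = begin
  ∑[ j ≤ ∣ V G ∣ ] ∑[ m ≤ toℕ j ] summand (toℕ j) (toℕ m)
    ≡⟨ ∑-single (suc ∣ V G ∣) (λ j → ∑[ m ≤ j ] summand j (toℕ m))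
         (s≤s (p⊆q⇒∣p∣≤∣q∣ (⋃-lub (All.map (proj₁ ∘ proj₂) bad))))
         (λ j j≢ → trans
           (sum-cong-≗ {suc j} (λ m → vanish j (toℕ m) λ (_ , _ , _ , eq) → j≢ (sym eq)))
           (sum-replicate-zero (suc j))) ⟩
  ∑[ m ≤ a ] summand a (toℕ m)
    ≡⟨ ∑-single (suc a) (summand a) (s≤s (length≤∣⋃∣ (All.map proj₁ bad) disj))
         (λ m m≢ → vanish a m λ (_ , _ , eq , _) → m≢ (sym eq)) ⟩
  summand a ℓ
    ≡⟨ cong (_* F a ℓ) (ι-cong (mk⇔ (λ (bad , disj , _) → bad , disj) (λ (bad , disj) → bad , disj , refl , refl))
         (isBadFamily? G a ℓ 𝓑) (yes (bad , disj))) ⟩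
  ι (yes (bad , disj)) * F a ℓ ∎
  where
  a = ∣ ⋃ 𝓑 ∣
  ℓ = length 𝓑

  summand : ℕ → ℕ → ℤ
  summand j m = ι (isBadFamily? G j m 𝓑) * F j m

  vanish : ∀ j m → ¬ IsBadFamily G j m 𝓑 → summand j m ≡ 0ℤ
  vanish j m ¬bad = cong (_* F j m) (ι-false (isBadFamily? G j m 𝓑) ¬bad)

theorem5 : (N : ℕ) → 0 < N → (n : ℕ) → n ≤ N → (G : Graph N) → ∣ V G ∣ ≡ n → (k : ℕ) → 0 < k → k ≤ N →
    + C k (K⁻ G) ≡ ∑[ j ≤ n ] ∑[ m ≤ toℕ j ] (-1ℤ ^ toℕ m * + b G (toℕ j) (toℕ m) * + S (N ∸ toℕ j) (+ k - + toℕ m))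
theorem5 N _ _ _ G refl k _ _ = begin
  + C k (K⁻ G)
    ≡⟨ C-expansion G k ⟩
  ∑[ 𝓑 ∈ families N ] (ι (badFamily? G 𝓑) * F ∣ ⋃ 𝓑 ∣ (length 𝓑))
    -- Each family is spread over all pairs `j`, `m`; after the sums are exchanged, the families at
    -- a fixed pair are those counted by `b`.
    ≡⟨ ∑∈-cong (families N) (∑-graded G F) ⟨
  ∑[ 𝓑 ∈ families N ] ∑[ j ≤ ∣ V G ∣ ] ∑[ m ≤ toℕ j ] (ι (isBadFamily? G (toℕ j) (toℕ m) 𝓑) * F (toℕ j) (toℕ m))
    ≡⟨ ∑-∑∈-comm (suc ∣ V G ∣) (families N) (λ j 𝓑 → ∑[ m ≤ j ] (ι (isBadFamily? G j (toℕ m) 𝓑) * F j (toℕ m))) ⟨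
  ∑[ j ≤ ∣ V G ∣ ] ∑[ 𝓑 ∈ families N ] ∑[ m ≤ toℕ j ] (ι (isBadFamily? G (toℕ j) (toℕ m) 𝓑) * F (toℕ j) (toℕ m))
    ≡⟨ sum-cong-≗ {suc ∣ V G ∣} (λ j → trans
         (sym (∑-∑∈-comm (suc (toℕ j)) (families N) (λ m 𝓑 → ι (isBadFamily? G (toℕ j) m 𝓑) * F (toℕ j) m)))
         (sum-cong-≗ {suc (toℕ j)} (λ m → count (toℕ j) (toℕ m)))) ⟩
  ∑[ j ≤ ∣ V G ∣ ] ∑[ m ≤ toℕ j ] (-1ℤ ^ toℕ m * + b G (toℕ j) (toℕ m) * + S (N ∸ toℕ j) (+ k - + toℕ m)) ∎
  where
  F : ℕ → ℕ → ℤ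
  F j m = -1ℤ ^ m * + S (N ∸ j) (+ k - + m)

  count : ∀ j m → ∑[ 𝓑 ∈ families N ] (ι (isBadFamily? G j m 𝓑) * F j m) ≡
    -1ℤ ^ m * + b G j m * + S (N ∸ j) (+ k - + m)
  count j m = begin
    ∑[ 𝓑 ∈ families N ] (ι (isBadFamily? G j m 𝓑) * F j m)
      ≡⟨ ∑∈-cong (families N) (λ 𝓑 → ℤ.*-comm (ι (isBadFamily? G j m 𝓑)) (F j m)) ⟩
    ∑[ 𝓑 ∈ families N ] (F j m * ι (isBadFamily? G j m 𝓑))
      ≡⟨ *-distribˡ-∑∈ (F j m) (families N) (λ 𝓑 → ι (isBadFamily? G j m 𝓑)) ⟨
    F j m * ∑[ 𝓑 ∈ families N ] ι (isBadFamily? G j m 𝓑)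
      ≡⟨ cong (F j m *_) (length-filter (isBadFamily? G j m) (families N)) ⟨
    F j m * + b G j m
      ≡⟨ swapʳ (-1ℤ ^ m) (+ S (N ∸ j) (+ k - + m)) (+ b G j m) ⟩
    -1ℤ ^ m * + b G j m * + S (N ∸ j) (+ k - + m) ∎
    where
    swapʳ : ∀ a b c → a * b * c ≡ a * c * b
    swapʳ = solve-∀
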